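{- Consider the game ${\rm SCN}(5,3)$. Its P-positions (among all configurations that can arise, i.e. circular arrangements of at most $5$ piles with positive pile sizes) are exactly the following: (1) the terminal configuration $()$; (2) $(a,a,a,a)$ with $a\ge 1$; (3) $(1,M,a,b,M)$ with integers $1\le a<b\le M$ and $1+M=a+b$; (4) $(2,2p,p+1,p,2p-1)$ with an integer $p\ge 2$.
   Context: Shrinking Circular Nim ${\rm SCN}(n,k)$, for positive integers $k\le n$: initially $n$ piles of stones are arranged on a circle. Two players alternate turns. On a turn, a player selects $k$ consecutive (cyclically adjacent) piles among the currently remaining piles and removes any number of stones from each of them, removing at least one stone in total (some of the selected piles may be left untouched). Whenever a pile becomes empty it vanishes and the circle closes up: the remaining piles keep their cyclic order and the neighbours of the vanished pile become adjacent. If at most $k$ piles remain, a move may remove stones from any of the remaining piles (all of them may be selected). The player who removes the last stone wins (a player with no move loses). A configuration is written as the tuple $(x_1,\dots,x_r)$ of the positive pile sizes in cyclic order; tuples that agree up to rotation or reflection denote the same configuration, and $()$ denotes the empty (terminal) configuration. A P-position is a configuration from which the player to move loses under optimal play by the opponent. -}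

module Defs where

open import Data.Nat using (ℕ; _≤_; _<_)
open import Data.List using (List; []; _∷_; _++_; take; drop; reverse; filter)
open import Data.Nat.ListAction using (sum)
open import Data.List.Relation.Binary.Pointwise using (Pointwise)
open import Data.Product using (∃; _×_)
open import Data.Sum using (_⊎_)
open import Relation.Binary.PropositionalEquality using (_≡_)
open import Relation.Nullary using (¬?)
open import Data.Nat using (_≟_)

-- Configurations are lists of pile sizes in cyclic order.

-- cyclic rotation by i (for i ≥ length xs this is the identity rotation)
rotate : ℕ → List ℕ → List ℕ
rotate i xs = drop i xs ++ take i xs

dropEmpty : List ℕ → List ℕ
dropEmpty = filter (λ x → ¬? (x ≟ 0))

-- A move in Shrinking Circular Nim with parameter k:
-- rotate so the selected k consecutive piles come first (if at most k piles
-- remain, take xs selects all of them), reduce each selected pile to some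
-- smaller-or-equal size removing at least one stone in total, then remove
-- the emptied piles.
Move : ℕ → List ℕ → List ℕ → Set
Move k xs ys =
  ∃ λ i → ∃ λ ws →
    Pointwise _≤_ ws (take k (rotate i xs)) ×
    sum ws < sum (take k (rotate i xs)) ×
    ys ≡ dropEmpty (ws ++ drop k (rotate i xs))

-- P-positions (player to move loses) and N-positions, defined inductively
-- (the game is well-founded: the total number of stones strictly decreases).
mutual
  data IsP (k : ℕ) (xs : List ℕ) : Set where
    isP : (∀ ys → Move k xs ys → IsN k ys) → IsP k xs

  data IsN (k : ℕ) (xs : List ℕ) : Set where
    isN : ∀ ys → Move k xs ys → IsP k ys → IsN k xs

infix 4 _∼_
_∼_ : List ℕ → List ℕ → Set
xs ∼ ys = ∃ λ i → ys ≡ rotate i xs ⊎ ys ≡ rotate i (reverse xs)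

{-# OPTIONS --safe #-}
module Submission where

-- The listed positions form the kernel of the move graph: no move joins two of
-- them, and every other position has a move into them.
--
-- For five piles a move leaves two adjacent piles untouched.  To reach the
-- kernel, read the circle from a smallest pile m as m, A, C, D, B with A ≤ B.
-- If M ≥ a stand next to each other and the piles beyond a are at least
-- M + 1 - a and M, one can move to (M,a,M+1-a,M,1), unless 2a = M + 1, where
-- family (4) serves as a substitute; if a ≠ b are adjacent and both their
-- outer neighbours are at least a + b - 1 = M, one can move to (a,b,M,1,M).
-- Comparing A with C, and then B and C with m + A, or A with C + D, yields such
-- a pair, up to the degenerate cases of two adjacent equal piles, which lead to
-- (a,a,a,a), and of m = 1, 2C = A + 1, where (1,A) is kept.
--
-- That no move joins two listed positions is, for each pair of families and
-- each of the finitely many relative orientations, the infeasibility of a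
-- linear system, and Fourier–Motzkin elimination decides it by evaluation.

open import Defs
open import Data.Nat using (ℕ; _≤_; _<_; _+_; _*_; _∸_)
open import Data.List using (List; []; _∷_; length)
open import Data.List.Relation.Unary.All using (All)
open import Data.Product using (∃; _×_)
open import Data.Sum using (_⊎_)
open import Relation.Binary.PropositionalEquality using (_≡_)
open import Function.Bundles using (_⇔_)

open import Data.Bool using (Bool; true; false; T)
open import Data.Bool.ListAction using (all; any)
open import Data.List using (_++_; [_]; concatMap; drop; foldr; map; replicate; reverse; take; upTo; zipWith)
open import Data.List.Properties hiding (sum-++)
open import Data.List.Membership.Propositional using (_∈_; lose)
open import Data.List.Membership.Propositional.Properties
open import Data.List.Relation.Binary.Permutation.Propositional using (_↭_; ↭-sym; ↭-trans)
open import Data.List.Relation.Binary.Permutation.Propositional.Properties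
  using (All-resp-↭; ++-comm; ↭-length; ↭-reverse)
open import Data.List.Relation.Binary.Pointwise as Pointwise using (Pointwise; []; _∷_)
open import Data.List.Relation.Unary.All as All using ([]; _∷_)
import Data.List.Relation.Unary.All.Properties as All
open import Data.List.Relation.Unary.Any using (here; there)
open import Data.Nat using (zero; suc; z≤n; s≤s; s≤s⁻¹; _<ᵇ_; _≟_; _≤?_; _<?_)
open import Data.Nat.Induction using (<-wellFounded)
open import Data.Nat.ListAction using (sum)
open import Data.Nat.ListAction.Properties using (sum-++; sum-↭)
open import Data.Nat.Properties hiding (_≟_; _≤?_; _<?_)
open import Data.Nat.Solver using (module +-*-Solver)
open import Data.Product using (∃₂; _,_; proj₁; proj₂)
open import Data.Sum using (inj₁; inj₂)
open import Data.Vec using (Vec; []; _∷_)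
import Data.Vec as Vec
open import Function.Bundles using (mk⇔)
open import Induction.WellFounded using (Acc; acc)
open import Relation.Binary.Definitions using (tri<; tri≈; tri>)
open import Relation.Binary.PropositionalEquality
  using (_≢_; refl; sym; trans; cong; cong₂; subst; subst₂; module ≡-Reasoning)
open import Relation.Nullary using (¬_; ¬?; yes; no; contradiction)
open import Data.List.Extrema ≤-totalOrder using (min; min≤⊤; min≤xs; argmin-sel)
open import Data.List.Membership.DecPropositional _≟_ using (_∈?_)

-- Fourier–Motzkin elimination over ℕ

-- A linear form with natural coefficients, one for each variable, the constant term last.
Form : ℕ → Set
Form n = Vec ℕ (suc n)

eval : ∀ {n} → Form n → Vec ℕ n → ℕ
eval (c ∷ [])     []      = c
eval (a ∷ f@(_ ∷ _)) (x ∷ ρ) = a * x + eval f ρ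

infix 4 _⊑_
-- Two-sided, so that negative coefficients never arise.
record Ineq (n : ℕ) : Set where
  constructor _⊑_
  field
    lhs rhs : Form n

Holds : ∀ {n} → Vec ℕ n → Ineq n → Set
Holds ρ (l ⊑ r) = eval l ρ ≤ eval r ρ

infixl 6 _⊕_
_⊕_ : ∀ {n} → Form n → Form n → Form n
_⊕_ = Vec.zipWith _+_

infixl 7 _⊛_
_⊛_ : ∀ {n} → ℕ → Form n → Form n
k ⊛ f = Vec.map (k *_) f

eval-⊕ : ∀ {n} (f g : Form n) ρ → eval (f ⊕ g) ρ ≡ eval f ρ + eval g ρ
eval-⊕ (c ∷ []) (d ∷ []) [] = refl
eval-⊕ (a ∷ f@(_ ∷ _)) (b ∷ g@(_ ∷ _)) (x ∷ ρ) rewrite eval-⊕ f g ρ =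
  solve 5 (λ a b x u v → (a :+ b) :* x :+ (u :+ v) := (a :* x :+ u) :+ (b :* x :+ v))
    refl a b x (eval f ρ) (eval g ρ)
  where open +-*-Solver

eval-⊛ : ∀ {n} k (f : Form n) ρ → eval (k ⊛ f) ρ ≡ k * eval f ρ
eval-⊛ k (c ∷ []) [] = refl
eval-⊛ k (a ∷ f@(_ ∷ _)) (x ∷ ρ) rewrite eval-⊛ k f ρ =
  solve 4 (λ k a x u → k :* a :* x :+ k :* u := k :* (a :* x :+ u)) refl k a x (eval f ρ)
  where open +-*-Solver

-- Both sides are the maximum of `m` and `n`.
m+[n∸m]≡n+[m∸n] : ∀ m n → m + (n ∸ m) ≡ n + (m ∸ n)
m+[n∸m]≡n+[m∸n] zero    n       = sym (trans (cong (n +_) (0∸n≡0 n)) (+-identityʳ n))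
m+[n∸m]≡n+[m∸n] (suc m) zero    = cong suc (+-identityʳ m)
m+[n∸m]≡n+[m∸n] (suc m) (suc n) = cong suc (m+[n∸m]≡n+[m∸n] m n)

-- Cancels common terms, so that each variable occurs on at most one side; `weaken` and `resolve`
-- recognise upper and lower bounds by that form.
balance : ∀ {n} → Ineq n → Ineq n
balance (l ⊑ r) = Vec.zipWith _∸_ l r ⊑ Vec.zipWith _∸_ r l

zip-balance : ∀ {n} (f g : Vec ℕ n) →
  Vec.zipWith _+_ f (Vec.zipWith _∸_ g f) ≡ Vec.zipWith _+_ g (Vec.zipWith _∸_ f g)
zip-balance []      []      = refl
zip-balance (a ∷ f) (b ∷ g) = cong₂ _∷_ (m+[n∸m]≡n+[m∸n] a b) (zip-balance f g)

balance-sound : ∀ {n} ρ (i : Ineq n) → Holds ρ i → Holds ρ (balance i)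
balance-sound ρ (l ⊑ r) l≤r = +-cancelˡ-≤ (eval l ρ) _ _ (begin
  eval l ρ + eval (Vec.zipWith _∸_ l r) ρ ≤⟨ +-monoˡ-≤ _ l≤r ⟩
  eval r ρ + eval (Vec.zipWith _∸_ l r) ρ ≡⟨ eval-⊕ r _ ρ ⟨
  eval (r ⊕ Vec.zipWith _∸_ l r) ρ        ≡⟨ cong (λ f → eval f ρ) (zip-balance r l) ⟩
  eval (l ⊕ Vec.zipWith _∸_ r l) ρ        ≡⟨ eval-⊕ l _ ρ ⟩
  eval l ρ + eval (Vec.zipWith _∸_ r l) ρ ∎)
  where open ≤-Reasoning

-- Accounts for the implicit constraint 0 ≤ x.
weaken : ∀ {n} → Ineq (suc n) → List (Ineq n)
weaken ((_ ∷ l) ⊑ (zero ∷ r))  = (l ⊑ r) ∷ []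
weaken ((_ ∷ _) ⊑ (suc _ ∷ _)) = []

-- An upper bound on the first variable, times `suc b`, is added to a lower bound, times `suc a`.
-- The variable then has the same coefficient on both sides and drops out.
resolve : ∀ {n} → Ineq (suc n) → Ineq (suc n) → List (Ineq n)
resolve ((suc a ∷ l) ⊑ (zero ∷ r)) ((zero ∷ l′) ⊑ (suc b ∷ r′)) =
  balance (suc b ⊛ l ⊕ suc a ⊛ l′ ⊑ suc b ⊛ r ⊕ suc a ⊛ r′) ∷ []
resolve _ _ = []

eliminate : ∀ {n} → List (Ineq (suc n)) → List (Ineq n)
eliminate is = concatMap (λ i → weaken i ++ concatMap (resolve i) is) is

-- With no variable left, a contradiction is a false inequality between constants. Only the answer
-- `true` is given a meaning, by `refutes-sound`.
refutes : ∀ {n} → List (Ineq n) → Bool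
refutes {zero}  is = any (λ { ((c ∷ []) ⊑ (d ∷ [])) → d <ᵇ c }) is
refutes {suc n} is = refutes (eliminate is)

weaken-sound : ∀ {n} x ρ (i : Ineq (suc n)) → Holds (x ∷ ρ) i → All (Holds ρ) (weaken i)
weaken-sound x ρ ((a ∷ l@(_ ∷ _)) ⊑ (zero ∷ r@(_ ∷ _))) h =
  ≤-trans (m≤n+m (eval l ρ) (a * x)) h ∷ []
weaken-sound x ρ ((_ ∷ _) ⊑ (suc _ ∷ _)) h = []

resolve-sound : ∀ {n} x ρ (i j : Ineq (suc n)) → Holds (x ∷ ρ) i → Holds (x ∷ ρ) j →
  All (Holds ρ) (resolve i j)
resolve-sound x ρ ((suc a ∷ l@(_ ∷ _)) ⊑ (zero ∷ r@(_ ∷ _)))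
                  ((zero ∷ l′@(_ ∷ _)) ⊑ (suc b ∷ r′@(_ ∷ _))) hi hj =
  balance-sound ρ (suc b ⊛ l ⊕ suc a ⊛ l′ ⊑ suc b ⊛ r ⊕ suc a ⊛ r′)
    (subst₂ _≤_ (expand l l′) (expand r r′)
      (+-cancelˡ-≤ (suc b * (suc a * x)) _ _ (begin
        suc b * (suc a * x) + (suc b * L + suc a * L′)
          ≡⟨ solve 5 (λ b a x u v → b :* (a :* x) :+ (b :* u :+ a :* v)
                                  := b :* (a :* x :+ u) :+ a :* v) refl (suc b) (suc a) x L L′ ⟩
        suc b * (suc a * x + L) + suc a * L′
          ≤⟨ +-mono-≤ (*-monoʳ-≤ (suc b) hi) (*-monoʳ-≤ (suc a) hj) ⟩
        suc b * R + suc a * (suc b * x + R′)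
          ≡⟨ solve 5 (λ b a x u v → b :* u :+ a :* (b :* x :+ v)
                                  := b :* (a :* x) :+ (b :* u :+ a :* v)) refl (suc b) (suc a) x R R′ ⟩
        suc b * (suc a * x) + (suc b * R + suc a * R′) ∎)))
    ∷ []
  where
  open ≤-Reasoning
  open +-*-Solver
  L L′ R R′ : ℕ
  L = eval l ρ
  L′ = eval l′ ρ
  R = eval r ρ
  R′ = eval r′ ρ
  expand : ∀ f g → suc b * eval f ρ + suc a * eval g ρ ≡ eval (suc b ⊛ f ⊕ suc a ⊛ g) ρ
  expand f g = sym (trans (eval-⊕ (suc b ⊛ f) (suc a ⊛ g) ρ)
                          (cong₂ _+_ (eval-⊛ (suc b) f ρ) (eval-⊛ (suc a) g ρ)))
resolve-sound x ρ ((zero ∷ _) ⊑ _) j _ _ = []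
resolve-sound x ρ ((suc _ ∷ _) ⊑ (suc _ ∷ _)) j _ _ = []
resolve-sound x ρ ((suc _ ∷ _) ⊑ (zero ∷ _)) ((suc _ ∷ _) ⊑ _) _ _ = []
resolve-sound x ρ ((suc _ ∷ _) ⊑ (zero ∷ _)) ((zero ∷ _) ⊑ (zero ∷ _)) _ _ = []

concatMap-All : ∀ {A B : Set} {P : B → Set} {Q : A → Set} (f : A → List B) →
  (∀ {x} → Q x → All P (f x)) → ∀ {xs} → All Q xs → All P (concatMap f xs)
concatMap-All f h []         = []
concatMap-All f h (qx ∷ qxs) = All.++⁺ (h qx) (concatMap-All f h qxs)

eliminate-sound : ∀ {n} x ρ (is : List (Ineq (suc n))) →
  All (Holds (x ∷ ρ)) is → All (Holds ρ) (eliminate is)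
eliminate-sound x ρ is hs = concatMap-All _
  (λ {i} hi → All.++⁺ (weaken-sound x ρ i hi)
                      (concatMap-All (resolve i) (λ {j} → resolve-sound x ρ i j hi) hs))
  hs

refutes-sound : ∀ {n} (is : List (Ineq n)) → T (refutes is) → ∀ ρ → ¬ All (Holds ρ) is
refutes-sound {zero} (((c ∷ []) ⊑ (d ∷ [])) ∷ is) t [] (h ∷ hs) with d <ᵇ c in eq
... | true  = <⇒≱ (<ᵇ⇒< d c (subst T (sym eq) _)) h
... | false = refutes-sound is t [] hs
refutes-sound {suc n} is t (x ∷ ρ) hs =
  refutes-sound (eliminate is) t ρ (eliminate-sound x ρ is hs)

-- Dihedral symmetry and the kernel of the game

-- Rotation as an exchange of two pieces: symmetric at sight and free of index arithmetic.
Cyclic : List ℕ → List ℕ → Set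
Cyclic xs ys = ∃₂ λ us vs → xs ≡ us ++ vs × ys ≡ vs ++ us

rotate-cyclic : ∀ i xs → Cyclic xs (rotate i xs)
rotate-cyclic i xs = take i xs , drop i xs , sym (take++drop≡id i xs) , refl

take-prefix : ∀ (us vs : List ℕ) → take (length us) (us ++ vs) ≡ us
take-prefix []       vs = refl
take-prefix (u ∷ us) vs = cong (u ∷_) (take-prefix us vs)

drop-prefix : ∀ (us vs : List ℕ) → drop (length us) (us ++ vs) ≡ vs
drop-prefix []       vs = refl
drop-prefix (_ ∷ us) vs = drop-prefix us vs

rotate-prefix : ∀ us vs → rotate (length us) (us ++ vs) ≡ vs ++ us
rotate-prefix us vs = cong₂ _++_ (drop-prefix us vs) (take-prefix us vs)

cyclic⇒rotate : ∀ {xs ys} → Cyclic xs ys → ∃ λ i → ys ≡ rotate i xs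
cyclic⇒rotate (us , vs , refl , refl) = length us , sym (rotate-prefix us vs)

cyclic-sym : ∀ {xs ys} → Cyclic xs ys → Cyclic ys xs
cyclic-sym (us , vs , p , q) = vs , us , q , p

cyclic-reverse : ∀ {xs ys} → Cyclic xs ys → Cyclic (reverse xs) (reverse ys)
cyclic-reverse (us , vs , refl , refl) =
  reverse vs , reverse us , reverse-++ us vs , reverse-++ vs us

-- Of two cuts of one list one comes first; `es` is the stretch between them. Two successive
-- rotations compose by this.
++-overlap : ∀ (as bs cs ds : List ℕ) → as ++ bs ≡ cs ++ ds →
  (∃ λ es → as ≡ cs ++ es × es ++ bs ≡ ds) ⊎ (∃ λ es → cs ≡ as ++ es × bs ≡ es ++ ds)
++-overlap []       bs cs       ds eq = inj₂ (cs , refl , eq)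
++-overlap (a ∷ as) bs []       ds eq = inj₁ (a ∷ as , refl , eq)
++-overlap (a ∷ as) bs (c ∷ cs) ds eq with ∷-injective eq
... | refl , eq′ with ++-overlap as bs cs ds eq′
...   | inj₁ (es , refl , q) = inj₁ (es , refl , q)
...   | inj₂ (es , refl , q) = inj₂ (es , refl , q)

cyclic-trans : ∀ {xs ys zs} → Cyclic xs ys → Cyclic ys zs → Cyclic xs zs
cyclic-trans (us , vs , refl , refl) (ps , qs , eq , refl) with ++-overlap vs us ps qs eq
... | inj₁ (es , refl , refl) =
  us ++ ps , es , sym (++-assoc us ps es) , ++-assoc es us ps
... | inj₂ (es , refl , refl) =
  es , qs ++ vs , ++-assoc es qs vs , sym (++-assoc qs vs es)

data Dihedral (xs ys : List ℕ) : Set where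
  turned  : Cyclic xs ys → Dihedral xs ys
  flipped : Cyclic (reverse xs) ys → Dihedral xs ys

∼⇒dihedral : ∀ {xs ys} → xs ∼ ys → Dihedral xs ys
∼⇒dihedral {xs} (i , inj₁ refl) = turned (rotate-cyclic i xs)
∼⇒dihedral {xs} (i , inj₂ refl) = flipped (rotate-cyclic i (reverse xs))

dihedral⇒∼ : ∀ {xs ys} → Dihedral xs ys → xs ∼ ys
dihedral⇒∼ (turned c)  with i , eq ← cyclic⇒rotate c = i , inj₁ eq
dihedral⇒∼ (flipped c) with i , eq ← cyclic⇒rotate c = i , inj₂ eq

cyclic⇒∼ : ∀ {xs ys} → Cyclic xs ys → xs ∼ ys
cyclic⇒∼ c = dihedral⇒∼ (turned c)

flip-cyclic : ∀ {xs ys} → Cyclic (reverse xs) ys → Cyclic xs (reverse ys)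
flip-cyclic {xs} {ys} c = subst (λ zs → Cyclic zs (reverse ys)) (reverse-involutive xs) (cyclic-reverse c)

∼-sym : ∀ {xs ys} → xs ∼ ys → ys ∼ xs
∼-sym p with ∼⇒dihedral p
... | turned c  = cyclic⇒∼ (cyclic-sym c)
... | flipped c = dihedral⇒∼ (flipped (cyclic-sym (flip-cyclic c)))

∼-trans : ∀ {xs ys zs} → xs ∼ ys → ys ∼ zs → xs ∼ zs
∼-trans p q with ∼⇒dihedral p | ∼⇒dihedral q
... | turned c  | turned d  = cyclic⇒∼ (cyclic-trans c d)
... | turned c  | flipped d = dihedral⇒∼ (flipped (cyclic-trans (cyclic-reverse c) d))
... | flipped c | turned d  = dihedral⇒∼ (flipped (cyclic-trans c d))
... | flipped c | flipped d = cyclic⇒∼ (cyclic-trans (flip-cyclic c) d)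

∼-refl : ∀ {xs} → xs ∼ xs
∼-refl {xs} = 0 , inj₁ (sym (++-identityʳ xs))

cyclic⇒↭ : ∀ {xs ys} → Cyclic xs ys → xs ↭ ys
cyclic⇒↭ (us , vs , refl , refl) = ++-comm us vs

∼⇒↭ : ∀ {xs ys} → xs ∼ ys → xs ↭ ys
∼⇒↭ {xs} p with ∼⇒dihedral p
... | turned c  = cyclic⇒↭ c
... | flipped c = ↭-trans (↭-sym (↭-reverse xs)) (cyclic⇒↭ c)

∼-length : ∀ {xs ys} → xs ∼ ys → length xs ≡ length ys
∼-length p = ↭-length (∼⇒↭ p)

-- Vanishing piles, and moves under rotation and reflection.

dropEmpty-++ : ∀ us vs → dropEmpty (us ++ vs) ≡ dropEmpty us ++ dropEmpty vs
dropEmpty-++ = filter-++ (λ x → ¬? (x ≟ 0))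

dropEmpty-reverse : ∀ xs → dropEmpty (reverse xs) ≡ reverse (dropEmpty xs)
dropEmpty-reverse []       = refl
dropEmpty-reverse (x ∷ xs) = begin
  dropEmpty (reverse (x ∷ xs))                ≡⟨ cong dropEmpty (unfold-reverse x xs) ⟩
  dropEmpty (reverse xs ++ [ x ])             ≡⟨ dropEmpty-++ (reverse xs) [ x ] ⟩
  dropEmpty (reverse xs) ++ dropEmpty [ x ]   ≡⟨ cong₂ _++_ (dropEmpty-reverse xs) (dropEmpty-single x) ⟩
  reverse (dropEmpty xs) ++ reverse (dropEmpty [ x ]) ≡⟨ reverse-++ (dropEmpty [ x ]) (dropEmpty xs) ⟨
  reverse (dropEmpty [ x ] ++ dropEmpty xs)   ≡⟨ cong reverse (dropEmpty-++ [ x ] xs) ⟨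
  reverse (dropEmpty (x ∷ xs))                ∎
  where
  open ≡-Reasoning
  dropEmpty-single : ∀ x → dropEmpty [ x ] ≡ reverse (dropEmpty [ x ])
  dropEmpty-single zero    = refl
  dropEmpty-single (suc _) = refl

dropEmpty-positive : ∀ {xs} → All (1 ≤_) xs → dropEmpty xs ≡ xs
dropEmpty-positive pos = filter-all (λ x → ¬? (x ≟ 0)) (All.map (λ 1≤x x≡0 → <⇒≢ 1≤x (sym x≡0)) pos)

dropEmpty-cyclic : ∀ {xs ys} → Cyclic xs ys → Cyclic (dropEmpty xs) (dropEmpty ys)
dropEmpty-cyclic (us , vs , refl , refl) =
  dropEmpty us , dropEmpty vs , dropEmpty-++ us vs , dropEmpty-++ vs us

dropEmpty-∼ : ∀ {xs ys} → xs ∼ ys → dropEmpty xs ∼ dropEmpty ys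
dropEmpty-∼ {xs} p with ∼⇒dihedral p
... | turned c  = cyclic⇒∼ (dropEmpty-cyclic c)
... | flipped c = dihedral⇒∼ (flipped (subst (λ zs → Cyclic zs _) (dropEmpty-reverse xs) (dropEmpty-cyclic c)))

-- The list that starts with the selected piles is a rotation of `xs′` as well, so only the index
-- changes.
move-cyclic : ∀ {k xs xs′ ys} → Cyclic xs xs′ → Move k xs ys → Move k xs′ ys
move-cyclic {k} {xs} {xs′} {ys} c (i , ws , m)
  with j , eq ← cyclic⇒rotate (cyclic-trans (cyclic-sym c) (rotate-cyclic i xs))
  = j , ws , subst (λ zs → Pointwise _≤_ ws (take k zs) × sum ws < sum (take k zs)
                         × ys ≡ dropEmpty (ws ++ drop k zs)) eq m

sum-reverse : ∀ xs → sum (reverse xs) ≡ sum xs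
sum-reverse xs = sum-↭ (↭-reverse xs)

take-drop-reverse : ∀ k (xs : List ℕ) →
  let ts = reverse (take k xs) ; ds = reverse (drop k xs) in
  take k (ts ++ ds) ≡ ts × drop k (ts ++ ds) ≡ ds
take-drop-reverse k xs with k ≤? length xs
... | yes k≤n = subst (λ j → take j (ts ++ ds) ≡ ts × drop j (ts ++ ds) ≡ ds) |ts|≡k
                  (take-prefix ts ds , drop-prefix ts ds)
  where
  ts ds : List ℕ
  ts = reverse (take k xs)
  ds = reverse (drop k xs)
  |ts|≡k : length ts ≡ k
  |ts|≡k = trans (length-reverse (take k xs)) (trans (length-take k xs) (m≤n⇒m⊓n≡m k≤n))
-- With fewer than `k` piles all are selected, and `ds` is empty.
... | no k≰n rewrite take-all k xs (≰⇒≥ k≰n) | drop-all k xs (≰⇒≥ k≰n) | ++-identityʳ (reverse xs) =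
  take-all k (reverse xs) n≤k , drop-all k (reverse xs) n≤k
  where
  n≤k : length (reverse xs) ≤ k
  n≤k = ≤-trans (≤-reflexive (length-reverse xs)) (≰⇒≥ k≰n)

-- Reflection sends the selected piles to the end; a rotation brings them back to the front. The
-- result is therefore the mirror image of `ys` only up to rotation.
move-reverse : ∀ {k xs ys} → Move k xs ys → ∃ λ ys′ → Move k (reverse xs) ys′ × ys ∼ ys′
move-reverse {k} {xs} {ys} (i , ws , ws≤ , sum< , refl) =
  dropEmpty (reverse ws ++ ds)
  , move-cyclic (cyclic-sym turn) (0 , reverse ws
      , subst (Pointwise _≤_ (reverse ws)) (sym take≡) (Pointwise.reverse⁺ ws≤)
      , subst₂ _<_ (sym (sum-reverse ws)) (trans (sym (sum-reverse (take k zs))) (cong sum (sym take≡))) sum<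
      , cong (λ es → dropEmpty (reverse ws ++ es)) (sym drop≡))
  , dropEmpty-∼ {ws ++ drop k zs} (dihedral⇒∼ (flipped (ds , reverse ws , reverse-++ ws (drop k zs) , refl)))
  where
  zs ts ds : List ℕ
  zs = rotate i xs
  ts = reverse (take k zs)
  ds = reverse (drop k zs)
  turn : Cyclic (reverse xs) (ts ++ ds)
  turn = cyclic-trans (cyclic-reverse (rotate-cyclic i xs))
           (ds , ts , trans (cong reverse (sym (take++drop≡id k zs))) (reverse-++ (take k zs) (drop k zs)) , refl)
  take≡ : take k (rotate 0 (ts ++ ds)) ≡ ts
  take≡ = trans (cong (take k) (++-identityʳ (ts ++ ds))) (proj₁ (take-drop-reverse k zs))
  drop≡ : drop k (rotate 0 (ts ++ ds)) ≡ ds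
  drop≡ = trans (cong (drop k) (++-identityʳ (ts ++ ds))) (proj₂ (take-drop-reverse k zs))

move-∼ : ∀ {k xs xs′ ys} → xs ∼ xs′ → Move k xs ys → ∃ λ ys′ → Move k xs′ ys′ × ys ∼ ys′
move-∼ {ys = ys} p m with ∼⇒dihedral p
... | turned c = ys , move-cyclic c m , ∼-refl
... | flipped c with ys′ , m′ , q ← move-reverse m = ys′ , move-cyclic c m′ , q

move-positive : ∀ {k xs ys} → Move k xs ys → All (1 ≤_) ys
move-positive (i , ws , _ , _ , refl) =
  All.map (λ {x} x≢0 → n≢0⇒n>0 x≢0) (All.all-filter (λ x → ¬? (x ≟ 0)) (ws ++ _))

length-replace : ∀ ws k (xs : List ℕ) → Pointwise _≤_ ws (take k xs) → length (ws ++ drop k xs) ≡ length xs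
length-replace ws k xs ws≤ = begin
  length (ws ++ drop k xs)              ≡⟨ length-++ ws ⟩
  length ws + length (drop k xs)        ≡⟨ cong (_+ length (drop k xs)) (Pointwise.Pointwise-length ws≤) ⟩
  length (take k xs) + length (drop k xs) ≡⟨ length-++ (take k xs) ⟨
  length (take k xs ++ drop k xs)       ≡⟨ cong length (take++drop≡id k xs) ⟩
  length xs                             ∎
  where open ≡-Reasoning

sum-replace : ∀ ws k (xs : List ℕ) → sum ws < sum (take k xs) → sum (ws ++ drop k xs) < sum xs
sum-replace ws k xs sum< = begin-strict
  sum (ws ++ drop k xs)             ≡⟨ sum-++ ws (drop k xs) ⟩
  sum ws + sum (drop k xs)          <⟨ +-monoˡ-< _ sum< ⟩
  sum (take k xs) + sum (drop k xs) ≡⟨ sum-++ (take k xs) (drop k xs) ⟨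
  sum (take k xs ++ drop k xs)      ≡⟨ cong sum (take++drop≡id k xs) ⟩
  sum xs                            ∎
  where open ≤-Reasoning

move-length : ∀ {k xs ys} → Move k xs ys → length ys ≤ length xs
move-length {k} {xs} (i , ws , ws≤ , _ , refl) = begin
  length (dropEmpty (ws ++ drop k zs)) ≤⟨ length-filter (λ x → ¬? (x ≟ 0)) (ws ++ drop k zs) ⟩
  length (ws ++ drop k zs)             ≡⟨ length-replace ws k zs ws≤ ⟩
  length zs                            ≡⟨ ↭-length (cyclic⇒↭ (rotate-cyclic i xs)) ⟨
  length xs                            ∎
  where
  open ≤-Reasoning
  zs : List ℕ
  zs = rotate i xs

sum-dropEmpty : ∀ xs → sum (dropEmpty xs) ≡ sum xs
sum-dropEmpty []           = refl
sum-dropEmpty (zero ∷ xs)  = sum-dropEmpty xs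
sum-dropEmpty (suc x ∷ xs) = cong (suc x +_) (sum-dropEmpty xs)

move-sum : ∀ {k xs ys} → Move k xs ys → sum ys < sum xs
move-sum {k} {xs} (i , ws , _ , sum< , refl) = begin-strict
  sum (dropEmpty (ws ++ drop k zs)) ≡⟨ sum-dropEmpty (ws ++ drop k zs) ⟩
  sum (ws ++ drop k zs)             <⟨ sum-replace ws k zs sum< ⟩
  sum zs                            ≡⟨ sum-↭ (cyclic⇒↭ (rotate-cyclic i xs)) ⟨
  sum xs                            ∎
  where
  open ≤-Reasoning
  zs : List ℕ
  zs = rotate i xs

-- P-positions as the kernel of a well-founded game.

P-N-exclusive : ∀ {k xs} → IsP k xs → ¬ IsN k xs
P-N-exclusive (isP p) (isN ys m py) = P-N-exclusive py (p ys m)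

-- `stable` and `absorbing` define a kernel of the move graph on the arena. Since the number of
-- stones drops with every move, such a kernel consists of exactly the P-positions.
module Kernel {k} (Arena Good : List ℕ → Set)
  (arena-move : ∀ {xs ys} → Arena xs → Move k xs ys → Arena ys)
  (stable     : ∀ {xs ys} → Good xs → Move k xs ys → ¬ Good ys)
  (absorbing  : ∀ {xs} → Arena xs → Good xs ⊎ ∃ λ ys → Move k xs ys × Good ys)
  where

  good⇒P : ∀ {xs} → Arena xs → Good xs → IsP k xs
  good⇒P = go (<-wellFounded _)
    where
    go : ∀ {xs} → Acc _<_ (sum xs) → Arena xs → Good xs → IsP k xs
    go {xs} (acc rec) arena good = isP reply
      where
      reply : ∀ ys → Move k xs ys → IsN k ys
      reply ys m with absorbing (arena-move arena m)
      ... | inj₁ good′ = contradiction good′ (stable good m)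
      -- The reply re-enters the kernel with two moves' worth of stones gone.
      ... | inj₂ (zs , m′ , good′) = isN zs m′
        (go (rec (<-trans (move-sum m′) (move-sum m))) (arena-move (arena-move arena m) m′) good′)

  P⇒good : ∀ {xs} → Arena xs → IsP k xs → Good xs
  P⇒good arena (isP p) with absorbing arena
  ... | inj₁ good = good
  ... | inj₂ (ys , m , good) =
    contradiction (p ys m) (P-N-exclusive (good⇒P (arena-move arena m) good))

-- Moves into the listed positions

Listed : List ℕ → Set
Listed c =
  c ≡ []
  ⊎ (∃ λ a → 1 ≤ a × c ∼ (a ∷ a ∷ a ∷ a ∷ []))
  ⊎ (∃ λ M → ∃ λ a → ∃ λ b →
       1 ≤ a × a < b × b ≤ M × 1 + M ≡ a + b × c ∼ (1 ∷ M ∷ a ∷ b ∷ M ∷ []))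
  ⊎ (∃ λ p → 2 ≤ p × c ∼ (2 ∷ 2 * p ∷ p + 1 ∷ p ∷ 2 * p ∸ 1 ∷ []))

pattern empty refl′                  = inj₁ refl′
pattern equal-four a 1≤a p           = inj₂ (inj₁ (a , 1≤a , p))
pattern one-M M a b 1≤a a<b b≤M e p  = inj₂ (inj₂ (inj₁ (M , a , b , 1≤a , a<b , b≤M , e , p)))
pattern two-p p 2≤p q                = inj₂ (inj₂ (inj₂ (p , 2≤p , q)))

listed-∼ : ∀ {xs ys} → xs ∼ ys → Listed xs → Listed ys
listed-∼ {[]} {[]}    p (empty refl) = empty refl
listed-∼ {[]} {_ ∷ _} p (empty refl) with () ← ∼-length p
listed-∼ p (equal-four a 1≤a q)          = equal-four a 1≤a (∼-trans (∼-sym p) q)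
listed-∼ p (one-M M a b 1≤a a<b b≤M e q) = one-M M a b 1≤a a<b b≤M e (∼-trans (∼-sym p) q)
listed-∼ p (two-p n 2≤n q)               = two-p n 2≤n (∼-trans (∼-sym p) q)

Settled : List ℕ → Set
Settled xs = Listed xs ⊎ ∃ λ ys → Move 3 xs ys × Listed ys

settled-∼ : ∀ {xs ys} → xs ∼ ys → Settled xs → Settled ys
settled-∼ p (inj₁ l) = inj₁ (listed-∼ p l)
settled-∼ p (inj₂ (zs , m , l)) with zs′ , m′ , q ← move-∼ p m = inj₂ (zs′ , m′ , listed-∼ q l)

sum-mono : ∀ {xs ys} → Pointwise _≤_ xs ys → sum xs ≤ sum ys
sum-mono []       = z≤n
sum-mono (p ∷ ps) = +-mono-≤ p (sum-mono ps)

pointwise-≤-< : ∀ {xs ys} → Pointwise _≤_ xs ys → xs ≡ ys ⊎ sum xs < sum ys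
pointwise-≤-< [] = inj₁ refl
pointwise-≤-< (p ∷ ps) with m≤n⇒m<n∨m≡n p | pointwise-≤-< ps
... | inj₁ x<y  | _         = inj₂ (+-mono-<-≤ x<y (sum-mono ps))
... | inj₂ refl | inj₁ refl = inj₁ refl
... | inj₂ refl | inj₂ lt   = inj₂ (+-monoʳ-< _ lt)

move-front : ∀ {xs} ws → Pointwise _≤_ ws (take 3 xs) → sum ws < sum (take 3 xs) →
  Move 3 xs (dropEmpty (ws ++ drop 3 xs))
move-front {xs} ws ws≤ sum< = move-cyclic (cyclic-sym (rotate-cyclic 0 xs)) (0 , ws , lemma)
  where
  lemma : Pointwise _≤_ ws (take 3 (rotate 0 (rotate 0 xs))) × sum ws < sum (take 3 (rotate 0 (rotate 0 xs)))
        × dropEmpty (ws ++ drop 3 xs) ≡ dropEmpty (ws ++ drop 3 (rotate 0 (rotate 0 xs)))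
  lemma rewrite ++-identityʳ xs | ++-identityʳ xs = ws≤ , sum< , refl

-- If `ws` lowers no pile, the position is itself listed; otherwise this is a legal move. Thus no
-- stone need be shown to be removed.
settle : ∀ {xs} ws → Pointwise _≤_ ws (take 3 xs) → All (1 ≤_) (ws ++ drop 3 xs) →
  Listed (ws ++ drop 3 xs) → Settled xs
settle {xs} ws ws≤ pos l with pointwise-≤-< ws≤
... | inj₁ refl = inj₁ (subst Listed (take++drop≡id 3 xs) l)
... | inj₂ lt   = inj₂ (_ , move-front ws ws≤ lt , subst Listed (sym (dropEmpty-positive pos)) l)

-- Reflection exchanges `a` and `b`, so they need only be distinct; the bound by `M` follows from
-- the sum.
listed-one-M : ∀ {M a b xs} → 1 ≤ a → 1 ≤ b → a ≢ b → 1 + M ≡ a + b →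
  (1 ∷ M ∷ a ∷ b ∷ M ∷ []) ∼ xs → Listed xs
listed-one-M {M} {a} {b} 1≤a 1≤b a≢b e p with <-cmp a b
... | tri< a<b _ _ = one-M M a b 1≤a a<b (bound 1≤a e) e (∼-sym p)
  where
  bound : ∀ {M a b} → 1 ≤ a → 1 + M ≡ a + b → b ≤ M
  bound {M} {a} {b} 1≤a e = +-cancelˡ-≤ 1 b M (≤-trans (+-monoˡ-≤ b 1≤a) (≤-reflexive (sym e)))
... | tri≈ _ a≡b _ = contradiction a≡b a≢b
... | tri> _ _ b<a = one-M M b a 1≤b b<a
    (+-cancelˡ-≤ 1 a M (≤-trans (+-monoˡ-≤ a 1≤b) (≤-reflexive (sym e′)))) e′
    (∼-trans (∼-sym p) (4 , inj₂ refl))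
  where
  e′ : 1 + M ≡ b + a
  e′ = trans e (+-comm a b)

-- In the lemmas below the two piles left untouched come last.

keep-equal : ∀ {x y z a} → 1 ≤ a → a ≤ x → 1 ≤ y → a ≤ z → Settled (x ∷ y ∷ z ∷ a ∷ a ∷ [])
keep-equal {x} {y} {z} {suc a} 1≤a a≤x 1≤y a≤z = inj₂ (_
  -- The pile `y` is emptied, which both leaves four piles and guarantees that a stone is removed.
  , move-front {x ∷ y ∷ z ∷ suc a ∷ suc a ∷ []} (suc a ∷ 0 ∷ suc a ∷ []) (a≤x ∷ z≤n ∷ a≤z ∷ [])
      (+-mono-≤-< a≤x (+-mono-<-≤ 1≤y (+-monoˡ-≤ 0 a≤z)))
  , equal-four (suc a) 1≤a ∼-refl)

keep-M-a : ∀ {x y z M a} → 1 ≤ a → a ≤ M → M < a + x → M ≤ y → 1 ≤ z → a + a ≢ suc M →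
  Settled (x ∷ y ∷ z ∷ M ∷ a ∷ [])
keep-M-a {x} {y} {z} {M} {a} 1≤a a≤M M<a+x M≤y 1≤z a+a≢1+M with k , refl ← m≤n⇒∃[o]m+o≡n a≤M =
  -- Here `M` is `a + k`, so the partner `M + 1 - a` of `a` is `suc k`.
  settle (suc k ∷ a + k ∷ 1 ∷ [])
    (+-cancelˡ-≤ a (suc k) x (≤-trans (≤-reflexive (+-suc a k)) M<a+x) ∷ M≤y ∷ 1≤z ∷ [])
    (s≤s z≤n ∷ 1≤a+k ∷ ≤-refl ∷ 1≤a+k ∷ 1≤a ∷ [])
    (listed-one-M 1≤a (s≤s z≤n) (λ a≡1+k → a+a≢1+M (trans (cong (a +_) a≡1+k) (+-suc a k)))
      (sym (+-suc a k)) (3 , inj₁ refl))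
  where
  1≤a+k : 1 ≤ a + k
  1≤a+k = ≤-trans 1≤a (m≤m+n a k)

keep-a-b : ∀ {x y z a b} → 1 ≤ a → 1 ≤ b → a ≢ b → a + b ≤ suc x → 1 ≤ y → a + b ≤ suc z →
  Settled (x ∷ y ∷ z ∷ a ∷ b ∷ [])
-- With the kept pile written `suc a`, the value of `M` is `a + b`, without subtraction.
keep-a-b {a = suc a} {b} 1≤a 1≤b a≢b (s≤s M≤x) 1≤y (s≤s M≤z) =
  settle (a + b ∷ 1 ∷ a + b ∷ []) (M≤x ∷ 1≤y ∷ M≤z ∷ [])
    (1≤a+b ∷ ≤-refl ∷ 1≤a+b ∷ 1≤a ∷ 1≤b ∷ [])
    (listed-one-M 1≤a 1≤b a≢b refl (4 , inj₁ refl))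
  where
  1≤a+b : 1 ≤ a + b
  1≤a+b = ≤-trans 1≤b (m≤n+m b a)

-- For `M = 2q + 1` the sum `1 + M` has equal halves `q + 1`, which are excluded; `q` and `q + 2`
-- are the closest distinct parts.
keep-1-M : ∀ {x y z q} → 1 ≤ q → q ≤ x → q + 2 ≤ y → suc (q + q) ≤ z →
  Settled (x ∷ y ∷ z ∷ 1 ∷ suc (q + q) ∷ [])
keep-1-M {q = q} 1≤q q≤x q+2≤y M≤z =
  settle (q ∷ q + 2 ∷ suc (q + q) ∷ []) (q≤x ∷ q+2≤y ∷ M≤z ∷ [])
    (1≤q ∷ ≤-trans 1≤q (m≤m+n q 2) ∷ s≤s z≤n ∷ ≤-refl ∷ s≤s z≤n ∷ [])
    (listed-one-M 1≤q (≤-trans 1≤q (m≤m+n q 2)) (<⇒≢ (m<m+n q (s≤s z≤n)))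
      (solve 1 (λ q → con 2 :+ (q :+ q) := q :+ (q :+ con 2)) refl q)
      (2 , inj₁ refl))
  where open +-*-Solver

-- The case excluded from `keep-M-a`: the partner of `p` would be `p` itself, and family (4)
-- replaces family (3).
keep-p : ∀ {x y z M p} → 2 ≤ p → p + p ≡ suc M → p < x → M < y → 2 ≤ z →
  Settled (x ∷ y ∷ z ∷ M ∷ p ∷ [])
keep-p {x} {M = M} {p} 2≤p 2p≡1+M p<x M<y 2≤z =
  settle (p + 1 ∷ 2 * p ∷ 2 ∷ [])
    (subst (_≤ x) (+-comm 1 p) p<x ∷ ≤-trans (≤-reflexive 2*p≡1+M) M<y ∷ 2≤z ∷ [])
    (m≤n+m 1 p ∷ ≤-trans 1≤p (m≤m+n p _) ∷ s≤s z≤n ∷ 1≤M ∷ 1≤p ∷ [])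
    (two-p p 2≤p (2 , inj₂ (cong (λ m → 2 ∷ 2 * p ∷ p + 1 ∷ p ∷ m ∷ []) (cong (_∸ 1) 2*p≡1+M))))
  where
  1≤p : 1 ≤ p
  1≤p = <⇒≤ 2≤p
  2*p≡1+M : 2 * p ≡ suc M
  2*p≡1+M = trans (cong (p +_) (+-identityʳ p)) 2p≡1+M
  1≤M : 1 ≤ M
  1≤M = s≤s⁻¹ (≤-trans 2≤p (≤-trans (m≤m+n p p) (≤-reflexive 2p≡1+M)))

-- In the next lemmas the circle is read from a smallest pile m.

-- If both `B` and `C` reach `m + A`, the piles `m` and `A` are kept. Otherwise the smaller of `B`
-- and `C` serves as `M`: `B` is kept with `m`, or `C` with `A`.
settle-high : ∀ {m A C D B} → 1 ≤ m → m < A → A ≤ B → A < C → m ≤ D →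
  Settled (m ∷ A ∷ C ∷ D ∷ B ∷ [])
settle-high {m} {A} {C} {D} {B} 1≤m m<A A≤B A<C m≤D = go
  where
  1≤D : 1 ≤ D
  1≤D = ≤-trans 1≤m m≤D
  both-large : m + A ≤ B → m + A ≤ C → Settled (m ∷ A ∷ C ∷ D ∷ B ∷ [])
  both-large ≤B ≤C = settled-∼ (3 , inj₁ refl)
    (keep-a-b 1≤m (<⇒≤ (≤-trans (s≤s 1≤m) m<A)) (<⇒≢ m<A) (m≤n⇒m≤1+n ≤C) 1≤D (m≤n⇒m≤1+n ≤B))
  go : Settled (m ∷ A ∷ C ∷ D ∷ B ∷ [])
  go with B <? C | B <? m + A | C <? m + A | m + m ≟ suc B
  ... | yes B<C | no B≮m+A | _ | _ =
    both-large (≮⇒≥ B≮m+A) (≤-trans (≮⇒≥ B≮m+A) (<⇒≤ B<C))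
  ... | yes B<C | yes B<m+A | _ | no 2m≢1+B = settled-∼ (4 , inj₁ refl)
    (keep-M-a 1≤m (≤-trans (<⇒≤ m<A) A≤B) B<m+A (<⇒≤ B<C) 1≤D 2m≢1+B)
  ... | yes B<C | yes _ | _ | yes 2m≡1+B = settled-∼ (4 , inj₁ refl)
    (keep-p 2≤m 2m≡1+B m<A B<C (≤-trans 2≤m m≤D))
    where
    2≤m : 2 ≤ m
    2≤m = +-cancelˡ-≤ m 2 m (begin
      m + 2       ≡⟨ +-comm m 2 ⟩
      suc (suc m) ≤⟨ s≤s (≤-trans m<A A≤B) ⟩
      suc B       ≡⟨ 2m≡1+B ⟨
      m + m       ∎)
      where open ≤-Reasoning
  ... | no B≮C | _ | no C≮m+A | _ =
    both-large (≤-trans (≮⇒≥ C≮m+A) (≮⇒≥ B≮C)) (≮⇒≥ C≮m+A)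
  -- Since `suc C ≤ m + A < A + A`, the exceptional equality cannot occur here.
  ... | no B≮C | _ | yes C<m+A | _ = settled-∼ (4 , inj₂ refl)
    (keep-M-a (≤-trans 1≤m (<⇒≤ m<A)) (<⇒≤ A<C) (subst (C <_) (+-comm m A) C<m+A) (≮⇒≥ B≮C) 1≤D
      (>⇒≢ (≤-trans (s≤s C<m+A) (+-monoˡ-< A m<A))))

-- The pair to keep is now `C`, `D` if they are equal or `A` reaches their sum, and otherwise `A`,
-- `C`. The exception `C + C ≡ suc A` is split by whether `m` is 1 and whether `A` equals `B`.
settle-low : ∀ {m A C D B} → 1 ≤ m → m < A → A ≤ B → C ≤ A → m ≤ C → m ≤ D →
  Settled (m ∷ A ∷ C ∷ D ∷ B ∷ [])
settle-low {m} {A} {C} {D} {B} 1≤m m<A A≤B C≤A m≤C m≤D with C ≟ D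
... | yes refl = settled-∼ (1 , inj₁ refl)
  (keep-equal (≤-trans 1≤m m≤C) (≤-trans C≤A A≤B) 1≤m C≤A)
... | no C≢D with A <? C + D | C + C ≟ suc A
...   | no A≮C+D | _ = settled-∼ (1 , inj₁ refl)
  (keep-a-b (≤-trans 1≤m m≤C) (≤-trans 1≤m m≤D) C≢D
    (m≤n⇒m≤1+n (≤-trans (≮⇒≥ A≮C+D) A≤B)) 1≤m (m≤n⇒m≤1+n (≮⇒≥ A≮C+D)))
...   | yes A<C+D | no 2C≢1+A = settled-∼ (2 , inj₁ refl)
  (keep-M-a (≤-trans 1≤m m≤C) C≤A A<C+D A≤B 1≤m 2C≢1+A)
...   | yes A<C+D | yes 2C≡1+A = go (m≤n⇒m<n∨m≡n 1≤m) (m≤n⇒m<n∨m≡n A≤B)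
  where
  C<D : C < D
  C<D = ≤∧≢⇒< (+-cancelˡ-≤ C C D (≤-trans (≤-reflexive 2C≡1+A) A<C+D)) C≢D
  minimal-one : ∀ {A C} → 1 < A → A ≤ B → C < D → C + C ≡ suc A → Settled (1 ∷ A ∷ C ∷ D ∷ B ∷ [])
  minimal-one {C = suc zero} 1<A _ _ refl = contradiction 1<A (λ { (s≤s ()) })
  minimal-one {C = suc q@(suc _)} _ A≤B C<D refl rewrite +-suc q q = settled-∼ (3 , inj₁ refl)
    (keep-1-M (s≤s z≤n) (n≤1+n q) (subst (_≤ D) (+-comm 2 q) C<D) A≤B)
  go : 1 < m ⊎ 1 ≡ m → A < B ⊎ A ≡ B → Settled (m ∷ A ∷ C ∷ D ∷ B ∷ [])
  go (inj₂ refl) _ = minimal-one m<A A≤B C<D 2C≡1+A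
  go (inj₁ 1<m) (inj₁ A<B) = settled-∼ (2 , inj₁ refl)
    (keep-p (≤-trans 1<m m≤C) 2C≡1+A C<D A<B 1<m)
  -- As `A` equals `B`, the circle may be reflected, and `D` takes the role of `C`; from `C < D` it
  -- follows that `D + D` exceeds `suc A`.
  go (inj₁ 1<m) (inj₂ refl) with D ≤? A
  ... | yes D≤A = settled-∼ (2 , inj₂ refl)
    (keep-M-a (≤-trans 1≤m m≤D) D≤A (subst (A <_) (+-comm C D) A<C+D) ≤-refl 1≤m
      (>⇒≢ (≤-trans (s≤s (≤-reflexive (sym 2C≡1+A))) (+-mono-< C<D C<D))))
  ... | no D≰A = settled-∼ (4 , inj₂ refl) (settle-high 1≤m m<A ≤-refl (≰⇒> D≰A) m≤C)

settle-ordered : ∀ {m A C D B} → 1 ≤ m → m ≤ A → m ≤ C → m ≤ D → A ≤ B →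
  Settled (m ∷ A ∷ C ∷ D ∷ B ∷ [])
settle-ordered {m} {A} {C} 1≤m m≤A m≤C m≤D A≤B with m≤n⇒m<n∨m≡n m≤A | C ≤? A
... | inj₂ refl | _      = settled-∼ (3 , inj₁ refl) (keep-equal 1≤m m≤C (≤-trans 1≤m m≤D) A≤B)
... | inj₁ m<A | yes C≤A = settle-low 1≤m m<A A≤B C≤A m≤C m≤D
... | inj₁ m<A | no C≰A  = settle-high 1≤m m<A A≤B (≰⇒> C≰A) m≤D

-- Up to three piles are cleared at once, four are levelled to the smallest, and for five a
-- reflection arranges `A ≤ B`.
settle-from-min : ∀ {m xs} → 1 ≤ m → All (m ≤_) xs → length xs ≤ 4 → Settled (m ∷ xs)
settle-from-min {m} {[]} 1≤m _ _ =
  inj₂ (_ , move-front (0 ∷ []) (z≤n ∷ []) (≤-trans 1≤m (m≤m+n m _)) , empty refl)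
settle-from-min {m} {_ ∷ []} 1≤m _ _ =
  inj₂ (_ , move-front (0 ∷ 0 ∷ []) (z≤n ∷ z≤n ∷ []) (≤-trans 1≤m (m≤m+n m _)) , empty refl)
settle-from-min {m} {_ ∷ _ ∷ []} 1≤m _ _ =
  inj₂ (_ , move-front (0 ∷ 0 ∷ 0 ∷ []) (z≤n ∷ z≤n ∷ z≤n ∷ []) (≤-trans 1≤m (m≤m+n m _)) , empty refl)
settle-from-min {m} {_ ∷ _ ∷ _ ∷ []} 1≤m m≤xs _ = settled-∼ (3 , inj₁ refl)
  (settle (m ∷ m ∷ m ∷ []) (pointwise m≤xs) (1≤m ∷ 1≤m ∷ 1≤m ∷ 1≤m ∷ []) (equal-four m 1≤m ∼-refl))
  where
  pointwise : ∀ {xs} → All (m ≤_) xs → Pointwise _≤_ (replicate (length xs) m) xs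
  pointwise []       = []
  pointwise (p ∷ ps) = p ∷ pointwise ps
settle-from-min {m} {A ∷ C ∷ D ∷ B ∷ []} 1≤m (m≤A ∷ m≤C ∷ m≤D ∷ m≤B ∷ []) _ with ≤-total A B
... | inj₁ A≤B = settle-ordered 1≤m m≤A m≤C m≤D A≤B
... | inj₂ B≤A = settled-∼ (4 , inj₂ refl) (settle-ordered 1≤m m≤B m≤D m≤C B≤A)
settle-from-min {xs = _ ∷ _ ∷ _ ∷ _ ∷ _ ∷ _} _ _ (s≤s (s≤s (s≤s (s≤s ()))))

-- Reading an arbitrary circle from a smallest pile.

min-∈ : ∀ x xs → min x xs ∈ x ∷ xs
min-∈ x xs with argmin-sel (λ y → y) x xs
... | inj₁ m≡x = here m≡x
... | inj₂ m∈  = there m∈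

rotate-to-min : ∀ x xs → ∃₂ λ m ys → (m ∷ ys) ∼ (x ∷ xs) × All (m ≤_) ys
rotate-to-min x xs with us , vs , eq ← ∈-∃++ (min-∈ x xs) =
  min x xs , vs ++ us , p
  , All.tail (All-resp-↭ (∼⇒↭ (∼-sym p)) (min≤⊤ x xs ∷ min≤xs x xs))
  where
  p : (min x xs ∷ vs ++ us) ∼ (x ∷ xs)
  p = cyclic⇒∼ (min x xs ∷ vs , us , refl , eq)

settled : ∀ {xs} → All (1 ≤_) xs → length xs ≤ 5 → Settled xs
settled {[]} _ _ = inj₁ (empty refl)
settled {x ∷ xs} pos len with m , ys , p , m≤ys ← rotate-to-min x xs =
  settled-∼ p (settle-from-min (All.head (All-resp-↭ (∼⇒↭ (∼-sym p)) pos)) m≤ys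
    (s≤s⁻¹ (≤-trans (≤-reflexive (∼-length p)) len)))

-- No move joins two listed positions

-- A parametrised family of positions: each pile is a linear form in the parameters.
Shape : ℕ → Set
Shape n = List (Form n)

instantiate : ∀ {n} → Vec ℕ n → Shape n → List ℕ
instantiate ρ = map (λ f → eval f ρ)

-- form i j c is the linear form i x + j y + c.
pattern form i j c = i ∷ j ∷ c ∷ []

-- Substituting a = x + 1, b = x + y + 2 in (1,M,a,b,M) and p = x + 2 in
-- (2,2p,p+1,p,2p-1) absorbs the side conditions into x, y ≥ 0; a configuration
-- of four piles is padded with an empty one.
noPiles equalFour oneM twoP : Shape 2
noPiles   = form 0 0 0 ∷ form 0 0 0 ∷ form 0 0 0 ∷ form 0 0 0 ∷ form 0 0 0 ∷ []
equalFour = form 0 0 0 ∷ form 1 0 1 ∷ form 1 0 1 ∷ form 1 0 1 ∷ form 1 0 1 ∷ []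
oneM      = form 0 0 1 ∷ form 2 1 2 ∷ form 1 0 1 ∷ form 1 1 2 ∷ form 2 1 2 ∷ []
twoP      = form 0 0 2 ∷ form 2 0 4 ∷ form 1 0 3 ∷ form 1 0 2 ∷ form 2 0 3 ∷ []

instantiate-equalFour : ∀ x → instantiate (x ∷ 0 ∷ []) equalFour ≡ 0 ∷ suc x ∷ suc x ∷ suc x ∷ suc x ∷ []
instantiate-equalFour x = Pointwise.Pointwise-≡⇒≡ (refl ∷ e ∷ e ∷ e ∷ e ∷ [])
  where
  open +-*-Solver
  e : 1 * x + 1 ≡ suc x
  e = solve 1 (λ x → con 1 :* x :+ con 1 := con 1 :+ x) refl x

instantiate-oneM : ∀ x y → let M = x + (2 + x + y) in
  instantiate (x ∷ y ∷ []) oneM ≡ 1 ∷ M ∷ suc x ∷ 2 + x + y ∷ M ∷ []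
instantiate-oneM x y = Pointwise.Pointwise-≡⇒≡ (refl ∷ M ∷ a ∷ b ∷ M ∷ [])
  where
  open +-*-Solver
  M : 2 * x + (1 * y + 2) ≡ x + (2 + x + y)
  M = solve 2 (λ x y → con 2 :* x :+ (con 1 :* y :+ con 2) := x :+ (con 2 :+ x :+ y)) refl x y
  a : 1 * x + 1 ≡ suc x
  a = solve 1 (λ x → con 1 :* x :+ con 1 := con 1 :+ x) refl x
  b : 1 * x + (1 * y + 2) ≡ 2 + x + y
  b = solve 2 (λ x y → con 1 :* x :+ (con 1 :* y :+ con 2) := con 2 :+ x :+ y) refl x y

instantiate-twoP : ∀ x → let p = 2 + x in
  instantiate (x ∷ 0 ∷ []) twoP ≡ 2 ∷ 2 * p ∷ p + 1 ∷ p ∷ 2 * p ∸ 1 ∷ []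
instantiate-twoP x = Pointwise.Pointwise-≡⇒≡ (refl ∷
  solve 1 (λ x → con 2 :* x :+ con 4 := con 2 :* (con 2 :+ x)) refl x ∷
  solve 1 (λ x → con 1 :* x :+ con 3 := con 2 :+ x :+ con 1) refl x ∷
  solve 1 (λ x → con 1 :* x :+ con 2 := con 2 :+ x) refl x ∷
  solve 1 (λ x → con 2 :* x :+ con 3 := con 1 :+ x :+ (con 2 :+ (x :+ con 0))) refl x ∷ [])
  where open +-*-Solver

constant-∼ : ∀ {a xs} → length xs ≡ 4 → xs ∼ (a ∷ a ∷ a ∷ a ∷ []) → xs ≡ a ∷ a ∷ a ∷ a ∷ []
constant-∼ {a} {w ∷ x ∷ y ∷ z ∷ []} _ p
  with refl ∷ refl ∷ refl ∷ refl ∷ [] ← All-resp-↭ {P = _≡ a} (∼⇒↭ (∼-sym p)) (refl ∷ refl ∷ refl ∷ refl ∷ []) = refl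

dropEmpty-full : ∀ {xs} → length (dropEmpty xs) ≡ length xs → dropEmpty xs ≡ xs
dropEmpty-full = filter-complete (λ x → ¬? (x ≟ 0))

dropEmpty-empty : ∀ xs → dropEmpty xs ≡ [] → xs ≡ replicate (length xs) 0
dropEmpty-empty []          _ = refl
dropEmpty-empty (zero ∷ xs) e = cong (0 ∷_) (dropEmpty-empty xs e)

-- One of the five slots must be empty, or five piles would remain. Rotated to the front, it leaves
-- four slots that are all nonempty, by counting.
padded-four : ∀ {a zs} → length zs ≡ 5 → dropEmpty zs ∼ (a ∷ a ∷ a ∷ a ∷ []) →
  zs ∼ (0 ∷ a ∷ a ∷ a ∷ a ∷ [])
padded-four {a} {zs} len p with 0 ∈? zs
... | no 0∉zs with () ← trans (sym (∼-length p))
      (trans (cong length (filter-all (λ x → ¬? (x ≟ 0)) (All.tabulate (λ x∈ x≡0 → 0∉zs (subst (_∈ zs) x≡0 x∈))))) len)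
... | yes 0∈zs with us , vs , refl ← ∈-∃++ 0∈zs =
  subst (λ ws → zs ∼ (0 ∷ ws)) (constant-∼ |ws|≡4 (subst (_∼ _) (dropEmpty-full |drop|) q)) z
  where
  ws : List ℕ
  ws = vs ++ us
  z : zs ∼ (0 ∷ ws)
  z = cyclic⇒∼ (us , 0 ∷ vs , refl , refl)
  q : dropEmpty ws ∼ (a ∷ a ∷ a ∷ a ∷ [])
  q = ∼-trans (∼-sym (dropEmpty-∼ z)) p
  |ws|≡4 : length ws ≡ 4
  |ws|≡4 = suc-injective (trans (sym (∼-length z)) len)
  |drop| : length (dropEmpty ws) ≡ length ws
  |drop| = trans (∼-length q) (sym |ws|≡4)

-- Listed positions as instances of five-slot shapes.

shapes : List (Shape 2)
shapes = noPiles ∷ equalFour ∷ oneM ∷ twoP ∷ []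

shapes-length : All (λ s → length s ≡ 5) shapes
shapes-length = refl ∷ refl ∷ refl ∷ refl ∷ []

record Instance (zs : List ℕ) : Set where
  constructor inst
  field
    {shape}    : Shape 2
    shape∈     : shape ∈ shapes
    parameters : Vec ℕ 2
    similar    : zs ∼ instantiate parameters shape

one-M-instance : ∀ {M a b zs} → 1 ≤ a → a < b → 1 + M ≡ a + b → zs ∼ (1 ∷ M ∷ a ∷ b ∷ M ∷ []) →
  ∃ λ ρ → zs ∼ instantiate ρ oneM
one-M-instance {a = suc x} {zs = zs} (s≤s _) a<b e p with y , refl ← m≤n⇒∃[o]m+o≡n a<b with refl ← e =
  x ∷ y ∷ [] , subst (zs ∼_) (sym (instantiate-oneM x y)) p

two-p-instance : ∀ {p zs} → 2 ≤ p → zs ∼ (2 ∷ 2 * p ∷ p + 1 ∷ p ∷ 2 * p ∸ 1 ∷ []) →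
  ∃ λ ρ → zs ∼ instantiate ρ twoP
two-p-instance {suc (suc x)} {zs} (s≤s (s≤s _)) p = x ∷ 0 ∷ [] , subst (zs ∼_) (sym (instantiate-twoP x)) p

-- `zs` is the outcome of a move before emptied piles vanish. With five slots throughout, source and
-- target can be compared slot by slot.
listed-instance : ∀ {zs} → length zs ≡ 5 → Listed (dropEmpty zs) → Instance zs
listed-instance {zs} len (empty e) = inst (here refl) (0 ∷ 0 ∷ [])
  (subst (zs ∼_) (trans (dropEmpty-empty zs e) (cong (λ n → replicate n 0) len)) ∼-refl)
listed-instance {zs} len (equal-four (suc x) _ p) = inst (there (here refl)) (x ∷ 0 ∷ [])
  (subst (zs ∼_) (sym (instantiate-equalFour x)) (padded-four len p))
listed-instance len (one-M M a b 1≤a a<b _ e p)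
  with ρ , q ← one-M-instance 1≤a a<b e (subst (_∼ _) (dropEmpty-full (trans (∼-length p) (sym len))) p)
  = inst (there (there (here refl))) ρ q
listed-instance len (two-p n 2≤n p)
  with ρ , q ← two-p-instance 2≤n (subst (_∼ _) (dropEmpty-full (trans (∼-length p) (sym len))) p)
  = inst (there (there (there (here refl)))) ρ q

-- Orbits of shapes and the linear systems of moves.

turnShape : ∀ {n} → ℕ → Shape n → Shape n
turnShape i s = drop i s ++ take i s

rotate-instantiate : ∀ {n} (ρ : Vec ℕ n) i s → rotate i (instantiate ρ s) ≡ instantiate ρ (turnShape i s)
rotate-instantiate ρ i s = trans (cong₂ _++_ (drop-map i s) (take-map i s)) (sym (map-++ _ (drop i s) (take i s)))

length-turnShape : ∀ {n} i (s : Shape n) → length (turnShape i s) ≡ length s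
length-turnShape i s = begin
  length (drop i s ++ take i s)         ≡⟨ length-++ (drop i s) ⟩
  length (drop i s) + length (take i s) ≡⟨ +-comm (length (drop i s)) _ ⟩
  length (take i s) + length (drop i s) ≡⟨ length-++ (take i s) ⟨
  length (take i s ++ drop i s)         ≡⟨ cong length (take++drop≡id i s) ⟩
  length s                              ∎
  where open ≡-Reasoning

turns orbit : ∀ {n} → Shape n → List (Shape n)
turns s = map (λ i → turnShape i s) (upTo 5)
orbit s = turns s ++ turns (reverse s)

turnShape-∈ : ∀ {n} i (s : Shape n) → length s ≡ 5 → turnShape i s ∈ turns s
turnShape-∈ i s len with i <? 5
... | yes i<5 = ∈-map⁺ (λ i → turnShape i s) (∈-upTo⁺ i<5)
... | no i≮5 rewrite drop-all i s (≤-trans (≤-reflexive len) (≮⇒≥ i≮5))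
                   | take-all i s (≤-trans (≤-reflexive len) (≮⇒≥ i≮5)) =
  subst (_∈ turns s) (++-identityʳ s) (here refl)

∼-orbit : ∀ {n} {ρ : Vec ℕ n} {s zs} → length s ≡ 5 → instantiate ρ s ∼ zs →
  ∃ λ t → t ∈ orbit s × zs ≡ instantiate ρ t
∼-orbit {ρ = ρ} {s} len (i , inj₁ e) =
  turnShape i s , ∈-++⁺ˡ (turnShape-∈ i s len) , trans e (rotate-instantiate ρ i s)
∼-orbit {ρ = ρ} {s} len (i , inj₂ e) =
  turnShape i (reverse s)
  , ∈-++⁺ʳ (turns s) (turnShape-∈ i (reverse s) (trans (length-reverse s) len))
  , trans e (trans (cong (rotate i) (sym (reverse-map _ s))) (rotate-instantiate ρ i (reverse s)))

-- Source and target have independent parameters, placed side by side in one system of four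
-- variables.
left right : Form 2 → Form 4
left  (form i j c) = i ∷ j ∷ 0 ∷ 0 ∷ c ∷ []
right (form i j c) = 0 ∷ 0 ∷ i ∷ j ∷ c ∷ []

join : Vec ℕ 2 → Vec ℕ 2 → Vec ℕ 4
join = Vec._++_

instantiate-left : ∀ ρ σ s → instantiate (join ρ σ) (map left s) ≡ instantiate ρ s
instantiate-left (_ ∷ _ ∷ []) (_ ∷ _ ∷ []) s =
  trans (sym (map-∘ s)) (map-cong (λ { (form _ _ _) → refl }) s)

instantiate-right : ∀ ρ σ s → instantiate (join ρ σ) (map right s) ≡ instantiate σ s
instantiate-right (_ ∷ _ ∷ []) (_ ∷ _ ∷ []) s =
  trans (sym (map-∘ s)) (map-cong (λ { (form _ _ _) → refl }) s)

const : ∀ {n} → ℕ → Form n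
const {zero}  c = c ∷ []
const {suc n} c = 0 ∷ const c

eval-const : ∀ {n} c (ρ : Vec ℕ n) → eval (const c) ρ ≡ c
eval-const c []      = refl
eval-const {suc (suc _)} c (x ∷ ρ) = eval-const c ρ
eval-const {suc zero} c (x ∷ []) = refl

total : ∀ {n} → Shape n → Form n
total = foldr _⊕_ (const 0)

eval-total : ∀ {n} (ρ : Vec ℕ n) s → eval (total s) ρ ≡ sum (instantiate ρ s)
eval-total ρ []      = eval-const 0 ρ
eval-total ρ (f ∷ s) = trans (eval-⊕ f (total s) ρ) (cong (eval f ρ +_) (eval-total ρ s))

-- The constraints on a move whose selected piles come first: no pile grows, the last two do not
-- shrink, and some stone is lost.
moveIneqs : ∀ {n} → Shape n → Shape n → List (Ineq n)
moveIneqs r t = zipWith _⊑_ t r ++ zipWith _⊑_ (drop 3 r) (drop 3 t) ++ (const 1 ⊕ total t ⊑ total r) ∷ []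

separates : Shape 2 → Shape 2 → Bool
separates r u = refutes (moveIneqs (map left r) (map right u))

-- A source is first brought to its standard orientation, so its rotations suffice; the target may
-- be reflected relative to it.
sources targets : List (Shape 2)
sources = concatMap turns shapes
targets = concatMap orbit shapes

sources-separated : T (all (λ r → all (separates r) targets) sources)
-- All 20 sources against all 40 targets: evaluation turns the type into the unit type.
sources-separated = _

holds-zipWith : ∀ {n} {ρ : Vec ℕ n} s t → Pointwise _≤_ (instantiate ρ s) (instantiate ρ t) →
  All (Holds ρ) (zipWith _⊑_ s t)
holds-zipWith []      []      []       = []
holds-zipWith (f ∷ s) (g ∷ t) (p ∷ ps) = p ∷ holds-zipWith s t ps

instance-unstable : ∀ {ρ σ r u} → r ∈ sources → u ∈ targets →
  let xs = instantiate ρ r ; ys = instantiate σ u in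
  Pointwise _≤_ ys xs → Pointwise _≤_ (drop 3 xs) (drop 3 ys) → ¬ sum ys < sum xs
instance-unstable {ρ} {σ} {r} {u} r∈ u∈ ys≤xs kept sum< =
  refutes-sound (moveIneqs r′ u′) refuted τ
    (All.++⁺ (holds-zipWith u′ r′ (subst₂ (Pointwise _≤_) (sym u≡) (sym r≡) ys≤xs))
    (All.++⁺ (holds-zipWith (drop 3 r′) (drop 3 u′)
               (subst₂ (Pointwise _≤_) (drop-instantiate r′ r≡) (drop-instantiate u′ u≡) kept))
    (subst₂ _≤_ (sym lhs) (sym rhs) sum< ∷ [])))
  where
  r′ u′ : Shape 4
  r′ = map left r
  u′ = map right u
  τ : Vec ℕ 4
  τ = join ρ σ
  r≡ : instantiate τ r′ ≡ instantiate ρ r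
  r≡ = instantiate-left ρ σ r
  u≡ : instantiate τ u′ ≡ instantiate σ u
  u≡ = instantiate-right ρ σ u
  drop-instantiate : ∀ {xs} s → instantiate τ s ≡ xs → drop 3 xs ≡ instantiate τ (drop 3 s)
  drop-instantiate s refl = drop-map 3 s
  lhs : eval (const 1 ⊕ total u′) τ ≡ suc (sum (instantiate σ u))
  lhs = trans (eval-⊕ (const 1) (total u′) τ)
          (cong₂ _+_ (eval-const 1 τ) (trans (eval-total τ u′) (cong sum u≡)))
  rhs : eval (total r′) τ ≡ sum (instantiate ρ r)
  rhs = trans (eval-total τ r′) (cong sum r≡)
  refuted : T (refutes (moveIneqs r′ u′))
  refuted = All.lookup (All.all⁺ (separates r) targets
    (All.lookup (All.all⁺ (λ r → all (separates r) targets) sources sources-separated) r∈)) u∈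

drop-replace : ∀ ws k (xs : List ℕ) → k ≤ length xs → Pointwise _≤_ ws (take k xs) →
  drop k (ws ++ drop k xs) ≡ drop k xs
drop-replace ws k xs k≤ ws≤ =
  subst (λ j → drop j (ws ++ drop k xs) ≡ drop k xs) |ws|≡k (drop-prefix ws (drop k xs))
  where
  |ws|≡k : length ws ≡ k
  |ws|≡k = trans (Pointwise.Pointwise-length ws≤) (trans (length-take k xs) (m≤n⇒m⊓n≡m k≤))

source-unstable : ∀ {ρ r xs} ws → r ∈ sources → length r ≡ 5 → instantiate ρ r ≡ xs →
  Pointwise _≤_ ws (take 3 xs) → sum ws < sum (take 3 xs) → ¬ Listed (dropEmpty (ws ++ drop 3 xs))
source-unstable {ρ} {r} ws r∈ |r|≡5 refl ws≤ sum< listed =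
  refute (listed-instance (trans (length-replace ws 3 xs ws≤) |xs|≡5) listed)
  where
  xs zs : List ℕ
  xs = instantiate ρ r
  zs = ws ++ drop 3 xs
  |xs|≡5 : length xs ≡ 5
  |xs|≡5 = trans (length-map _ r) |r|≡5
  zs≤xs : Pointwise _≤_ zs xs
  zs≤xs = subst (Pointwise _≤_ zs) (take++drop≡id 3 xs) (Pointwise.++⁺ ws≤ (Pointwise.refl ≤-refl))
  kept : drop 3 zs ≡ drop 3 xs
  kept = drop-replace ws 3 xs (≤-trans (m≤m+n 3 2) (≤-reflexive (sym |xs|≡5))) ws≤
  refute : ¬ Instance zs
  refute (inst t∈ σ p) with u , u∈ , zs≡ ← ∼-orbit (All.lookup shapes-length t∈) (∼-sym p) =
    instance-unstable r∈ (∈-concatMap⁺ orbit (lose t∈ u∈))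
      (subst (λ ys → Pointwise _≤_ ys xs) zs≡ zs≤xs)
      (subst (Pointwise _≤_ (drop 3 xs)) (trans (sym kept) (cong (drop 3) zs≡)) (Pointwise.refl ≤-refl))
      (subst (λ ys → sum ys < sum xs) zs≡ (sum-replace ws 3 xs sum<))

turn-source : ∀ i {s} → s ∈ shapes → turnShape i s ∈ sources
turn-source i {s} s∈ =
  ∈-concatMap⁺ turns {xs = shapes} (lose s∈ (turnShape-∈ i s (All.lookup shapes-length s∈)))

shape-unstable : ∀ ρ {s xs ys} → s ∈ shapes → xs ∼ instantiate ρ s → Move 3 xs ys → ¬ Listed ys
shape-unstable ρ {s} s∈ p m listed with ys′ , (i , ws , ws≤ , sum< , refl) , q ← move-∼ p m =
  source-unstable ws (turn-source i s∈)
    (trans (length-turnShape i s) |s|≡5) (sym (rotate-instantiate ρ i s)) ws≤ sum< (listed-∼ q listed)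
  where
  |s|≡5 : length s ≡ 5
  |s|≡5 = All.lookup shapes-length s∈

-- A move on four equal piles is a move on the same piles followed by an empty one.
four-unstable : ∀ {x xs ys} → xs ∼ (suc x ∷ suc x ∷ suc x ∷ suc x ∷ []) → Move 3 xs ys → ¬ Listed ys
four-unstable {x} p m listed with ys′ , (i , ws , ws≤ , sum< , refl) , q ← move-∼ p m
  with r ← cyclic⇒∼ (rotate-cyclic i (suc x ∷ suc x ∷ suc x ∷ suc x ∷ []))
  rewrite constant-∼ (sym (∼-length r)) (∼-sym r) =
  -- Turned by one, the empty pile comes last, so the three selected piles agree with those of the
  -- unpadded list.
  source-unstable {x ∷ 0 ∷ []} {turnShape 1 equalFour} ws
    (turn-source 1 (there (here refl))) refl
    (trans (sym (rotate-instantiate (x ∷ 0 ∷ []) 1 equalFour)) (cong (rotate 1) (instantiate-equalFour x)))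
    ws≤ sum<
    (subst Listed (trans (dropEmpty-++ ws (suc x ∷ [])) (sym (dropEmpty-++ ws (suc x ∷ 0 ∷ [])))) (listed-∼ q listed))

listed-unstable : ∀ {xs ys} → Listed xs → Move 3 xs ys → ¬ Listed ys
listed-unstable (empty refl) (i , ws , _ , sum< , _) rewrite drop-[] {A = ℕ} i | take-[] {A = ℕ} i =
  contradiction sum< λ ()
listed-unstable (equal-four (suc x) 1≤a p) m = four-unstable p m
listed-unstable (one-M M a b 1≤a a<b _ e p) m with ρ , q ← one-M-instance 1≤a a<b e p =
  shape-unstable ρ (there (there (here refl))) q m
listed-unstable (two-p n 2≤n p) m with ρ , q ← two-p-instance 2≤n p =
  shape-unstable ρ (there (there (there (here refl)))) q m

-- The arena of SCN(5,3) and the conclusion.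

Arena : List ℕ → Set
Arena xs = All (1 ≤_) xs × length xs ≤ 5

arena-move : ∀ {xs ys} → Arena xs → Move 3 xs ys → Arena ys
arena-move (_ , len) m = move-positive m , ≤-trans (move-length m) len

arena-settled : ∀ {xs} → Arena xs → Settled xs
arena-settled (pos , len) = settled pos len

theorem3p4 : (c : List ℕ) → All (λ x → 1 ≤ x) c → length c ≤ 5 →
  (IsP 3 c ⇔
    (c ≡ []
    ⊎ (∃ λ a → 1 ≤ a × c ∼ (a ∷ a ∷ a ∷ a ∷ []))
    ⊎ (∃ λ M → ∃ λ a → ∃ λ b →
         1 ≤ a × a < b × b ≤ M × 1 + M ≡ a + b × c ∼ (1 ∷ M ∷ a ∷ b ∷ M ∷ []))
    ⊎ (∃ λ p → 2 ≤ p × c ∼ (2 ∷ 2 * p ∷ p + 1 ∷ p ∷ 2 * p ∸ 1 ∷ []))))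
theorem3p4 c pos len = mk⇔ (P⇒good (pos , len)) (good⇒P (pos , len))
  where
  open Kernel Arena Listed arena-move listed-unstable arena-settled
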